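{- Let $A$ and $B$ be AL-monoids and let $\alpha : A \to B$ be a homomorphism of AL-monoids. Then $\ker(\alpha)$ is a prime ideal of $A$ if and only if $\operatorname{Im}(\alpha)$ is a chain AL-monoid (i.e. an AL-monoid whose lattice order is total).
   Context: An AL-monoid (autometrized lattice ordered monoid) is an algebra $(A,+,\vee,\wedge,\ast,0)$ of arity $(2,2,2,2,0)$ such that: (1) $(A,+,\vee,\wedge,0)$ is a commutative lattice ordered monoid, i.e. $(A,+,0)$ is a commutative monoid, $(A,\vee,\wedge)$ is a lattice with induced order $\leq$, and $+$ distributes over $\vee$ and over $\wedge$; (2) $a\ast(a\wedge b)+b=a\vee b$ for all $a,b\in A$; (3) for each $a\in A$ the maps $x\mapsto a+x$, $x\mapsto a\vee x$, $x\mapsto a\wedge x$, $x\mapsto a\ast x$ are contractions with respect to $\ast$, where $f:A\to A$ is a contraction if $f(x)\ast f(y)\leq x\ast y$ for all $x,y\in A$; (4) $[a\ast(a\vee b)]\wedge[b\ast(a\vee b)]=0$ for all $a,b\in A$. An ideal of $A$ is a nonempty subset $I\subseteq A$ such that $a,b\in I$ implies $a+b\in I$, and $a\in I$, $b\in A$, $b\ast 0\leq a\ast 0$ imply $b\in I$. An ideal $P$ is prime if for all ideals $I,J$ of $A$, $I\cap J\subseteq P$ implies $I\subseteq P$ or $J\subseteq P$ (here $P=A$ is allowed). A homomorphism $f:A\to B$ of AL-monoids is a map preserving $+,\ast,\vee,\wedge$ and $0$. $\ker(\alpha)=\{a\in A: \alpha(a)=0\}$ and $\operatorname{Im}(\alpha)=\{\alpha(a):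 a\in A\}$. -}

module Defs where

open import Level using (Level; _⊔_; suc)
open import Algebra.Core using (Op₂)
import Algebra.Definitions as AlgebraicDefinitions
open import Algebra.Structures using (IsCommutativeMonoid)
open import Algebra.Lattice.Structures using (IsLattice)
import Algebra.Morphism.Definitions as MorphismDefinitions
open import Data.Product using (Σ; ∃; _,_; proj₁; proj₂)
open import Data.Sum using (_⊎_)
open import Relation.Binary.Core using (Rel)
open import Relation.Binary.Definitions using (Total)
import Relation.Binary.Construct.NaturalOrder.Left as NaturalOrder
open import Relation.Unary using (Pred; _∈_; _⊆_; _∩_; Satisfiable)

private
  variable
    c ℓ p : Level

module _ {A : Set c} (_≈_ : Rel A ℓ) (_+_ _∨_ _∧_ _∗_ : Op₂ A) (0# : A) where

  private
    -- The lattice order:  x ≤ y  is  x ≈ x ∧ y.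
    open NaturalOrder _≈_ _∧_ using (_≤_)

    IsContraction : (A → A) → Set (c ⊔ ℓ)
    IsContraction f = ∀ x y → (f x ∗ f y) ≤ (x ∗ y)

  open AlgebraicDefinitions _≈_ using (Congruent₂; _DistributesOver_)

  record IsALMonoid : Set (c ⊔ ℓ) where
    field
      +-isCommutativeMonoid : IsCommutativeMonoid _≈_ _+_ 0#
      isLattice             : IsLattice _≈_ _∨_ _∧_
      +-distrib-∨           : _+_ DistributesOver _∨_
      +-distrib-∧           : _+_ DistributesOver _∧_
      ∗-cong                : Congruent₂ _∗_
      ∗-∧-+                 : ∀ a b → ((a ∗ (a ∧ b)) + b) ≈ (a ∨ b)
      +-contraction         : ∀ a → IsContraction (λ x → a + x)
      ∨-contraction         : ∀ a → IsContraction (λ x → a ∨ x)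
      ∧-contraction         : ∀ a → IsContraction (λ x → a ∧ x)
      ∗-contraction         : ∀ a → IsContraction (λ x → a ∗ x)
      ∗-∨-disjoint          : ∀ a b → ((a ∗ (a ∨ b)) ∧ (b ∗ (a ∨ b))) ≈ 0#

record ALMonoid c ℓ : Set (suc (c ⊔ ℓ)) where
  infixl 8 _∗_
  infixl 7 _∧_
  infixl 6 _∨_ _+_
  infix  4 _≈_
  field
    Carrier    : Set c
    _≈_        : Rel Carrier ℓ
    _+_        : Op₂ Carrier
    _∨_        : Op₂ Carrier
    _∧_        : Op₂ Carrier
    _∗_        : Op₂ Carrier
    0#         : Carrier
    isALMonoid : IsALMonoid _≈_ _+_ _∨_ _∧_ _∗_ 0#

  open IsALMonoid isALMonoid public
  open NaturalOrder _≈_ _∧_ public using (_≤_)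

-- Antisymmetry and transitivity of _≤_ hold in every lattice, so being a
-- chain is totality alone.
IsChain : ALMonoid c ℓ → Set (c ⊔ ℓ)
IsChain A = Total _≤_
  where open ALMonoid A

module _ (A : ALMonoid c ℓ) where
  open ALMonoid A

  -- Closure under  b ∗ 0# ≤ a ∗ 0#  makes every ideal closed under _≈_, so no
  -- separate field is needed for that.
  record IsIdeal (I : Pred Carrier p) : Set (c ⊔ ℓ ⊔ p) where
    field
      nonempty : Satisfiable I
      +-closed : ∀ {a b} → a ∈ I → b ∈ I → (a + b) ∈ I
      ∗-closed : ∀ {a b} → a ∈ I → (b ∗ 0#) ≤ (a ∗ 0#) → b ∈ I

  -- Primes need not be proper.
  record IsPrimeIdeal (P : Pred Carrier p) : Set (c ⊔ ℓ ⊔ suc p) where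
    field
      isIdeal : IsIdeal P
      prime   : (I J : Pred Carrier p) → IsIdeal I → IsIdeal J →
                (I ∩ J) ⊆ P → (I ⊆ P) ⊎ (J ⊆ P)

module _ (A B : ALMonoid c ℓ) where
  private
    module A = ALMonoid A
    module B = ALMonoid B
  open MorphismDefinitions A.Carrier B.Carrier B._≈_
    using (Homomorphic₀; Homomorphic₂)

  record ALMonoidHomomorphism : Set (c ⊔ ℓ) where
    field
      ⟦_⟧     : A.Carrier → B.Carrier
      ⟦⟧-cong : ∀ {x y} → x A.≈ y → ⟦ x ⟧ B.≈ ⟦ y ⟧
      +-homo  : Homomorphic₂ ⟦_⟧ A._+_ B._+_
      ∗-homo  : Homomorphic₂ ⟦_⟧ A._∗_ B._∗_
      ∨-homo  : Homomorphic₂ ⟦_⟧ A._∨_ B._∨_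
      ∧-homo  : Homomorphic₂ ⟦_⟧ A._∧_ B._∧_
      0#-homo : Homomorphic₀ ⟦_⟧ A.0# B.0#

module _ {A B : ALMonoid c ℓ} (α : ALMonoidHomomorphism A B) where
  private
    module A = ALMonoid A
    module B = ALMonoid B
    module M = IsCommutativeMonoid B.+-isCommutativeMonoid
    module L = IsLattice B.isLattice
  open ALMonoidHomomorphism α

  ker : Pred A.Carrier ℓ
  ker a = ⟦ a ⟧ B.≈ B.0#

  Im : Pred B.Carrier (c ⊔ ℓ)
  Im b = ∃ λ a → ⟦ a ⟧ B.≈ b

  private
    lift₂ : {_∙_ : Op₂ A.Carrier} {_∘_ : Op₂ B.Carrier} →
            (∀ x y → ⟦ x ∙ y ⟧ B.≈ (⟦ x ⟧ ∘ ⟦ y ⟧)) →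
            (∀ {x y u v} → x B.≈ y → u B.≈ v → (x ∘ u) B.≈ (y ∘ v)) →
            Op₂ (Σ B.Carrier Im)
    lift₂ {_∙_} {_∘_} homo cong (x , a , p) (y , b , q) =
      (x ∘ y) , (a ∙ b) , M.trans (homo a b) (cong p q)

  -- Elements of the image are elements of B together with a preimage; the
  -- preimage is ignored by the equality.
  image : ALMonoid (c ⊔ ℓ) ℓ
  image = record
    { Carrier = Σ B.Carrier Im
    ; _≈_     = λ x y → proj₁ x B.≈ proj₁ y
    ; _+_     = lift₂ +-homo M.∙-cong
    ; _∨_     = lift₂ ∨-homo L.∨-cong
    ; _∧_     = lift₂ ∧-homo L.∧-cong
    ; _∗_     = lift₂ ∗-homo B.∗-cong
    ; 0#      = B.0# , A.0# , 0#-homo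
    ; isALMonoid = record
      { +-isCommutativeMonoid = record
        { isMonoid = record
          { isSemigroup = record
            { isMagma = record
              { isEquivalence = record
                { refl = M.refl ; sym = M.sym ; trans = M.trans }
              ; ∙-cong = M.∙-cong
              }
            ; assoc = λ x y z → M.assoc (proj₁ x) (proj₁ y) (proj₁ z)
            }
          ; identity = (λ x → M.identityˡ (proj₁ x))
                     , (λ x → M.identityʳ (proj₁ x))
          }
        ; comm = λ x y → M.comm (proj₁ x) (proj₁ y)
        }
      ; isLattice = record
        { isEquivalence = record
          { refl = M.refl ; sym = M.sym ; trans = M.trans }
        ; ∨-comm  = λ x y → L.∨-comm (proj₁ x) (proj₁ y)
        ; ∨-assoc = λ x y z → L.∨-assoc (proj₁ x) (proj₁ y) (proj₁ z)
        ; ∨-cong  = L.∨-cong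
        ; ∧-comm  = λ x y → L.∧-comm (proj₁ x) (proj₁ y)
        ; ∧-assoc = λ x y z → L.∧-assoc (proj₁ x) (proj₁ y) (proj₁ z)
        ; ∧-cong  = L.∧-cong
        ; absorptive = (λ x y → L.∨-absorbs-∧ (proj₁ x) (proj₁ y))
                     , (λ x y → L.∧-absorbs-∨ (proj₁ x) (proj₁ y))
        }
      ; +-distrib-∨ =
          (λ x y z → proj₁ B.+-distrib-∨ (proj₁ x) (proj₁ y) (proj₁ z))
        , (λ x y z → proj₂ B.+-distrib-∨ (proj₁ x) (proj₁ y) (proj₁ z))
      ; +-distrib-∧ =
          (λ x y z → proj₁ B.+-distrib-∧ (proj₁ x) (proj₁ y) (proj₁ z))
        , (λ x y z → proj₂ B.+-distrib-∧ (proj₁ x) (proj₁ y) (proj₁ z))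
      ; ∗-cong = B.∗-cong
      ; ∗-∧-+ = λ a b → B.∗-∧-+ (proj₁ a) (proj₁ b)
      ; +-contraction = λ a x y → B.+-contraction (proj₁ a) (proj₁ x) (proj₁ y)
      ; ∨-contraction = λ a x y → B.∨-contraction (proj₁ a) (proj₁ x) (proj₁ y)
      ; ∧-contraction = λ a x y → B.∧-contraction (proj₁ a) (proj₁ x) (proj₁ y)
      ; ∗-contraction = λ a x y → B.∗-contraction (proj₁ a) (proj₁ x) (proj₁ y)
      ; ∗-∨-disjoint = λ a b → B.∗-∨-disjoint (proj₁ a) (proj₁ b)
      }
    }

{-# OPTIONS --safe #-}

-- The operation ∗ is a metric with values in the nonnegative elements; write
-- ∣x∣ for x ∗ 0. The elements u = x ∗ (x ∨ y) and v = y ∗ (x ∨ y) are disjoint,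
-- so v lies in the polar {z : ∣z∣ ∧ u = 0}, an ideal meeting the principal ideal
-- of u only in 0. If ker α is prime, α therefore kills u or v, which means
-- α y ≤ α x or α x ≤ α y. Conversely, x ∈ I and y ∈ J give ∣x∣ ∧ ∣y∣ ∈ I ∩ J;
-- when the image is a chain, α (∣x∣ ∧ ∣y∣) is ∣α x∣ or ∣α y∣, so I ∩ J ⊆ ker α
-- forces α x = 0 or α y = 0.

module Submission where

open import Level using (Level; _⊔_; Lift; lift; lower)
open import Axiom.DoubleNegationElimination using (DoubleNegationElimination; em⇒dne)
open import Axiom.ExcludedMiddle using (ExcludedMiddle)
open import Algebra.Bundles using (CommutativeMonoid)
open import Algebra.Lattice.Bundles using (Lattice)
import Algebra.Lattice.Properties.Lattice as LatticeProperties
import Algebra.Properties.Monoid.Mult as Mult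
open import Data.Nat.Base using (zero; suc)
import Data.Nat.Base as ℕ
open import Data.Product using (∃; _,_; proj₂)
open import Data.Sum using (_⊎_; inj₁; inj₂; map; fromInj₂)
open import Function.Base using (_∘_)
open import Function.Bundles using (_⇔_; mk⇔)
import Relation.Binary.Lattice as OrderTheoretic
import Relation.Binary.Lattice.Properties.MeetSemilattice as MeetProperties
import Relation.Binary.Reasoning.PartialOrder as PosetReasoning
open import Relation.Nullary.Decidable using (yes; no)
open import Relation.Nullary.Negation using (contradiction)
open import Relation.Unary using (Pred; _∈_; _⊆_; _∩_)
open import Defs

private
  variable
    c ℓ p : Level

module ALMonoidProperties (A : ALMonoid c ℓ) where
  open ALMonoid A public

  +-commutativeMonoid : CommutativeMonoid c ℓ
  +-commutativeMonoid = record { isCommutativeMonoid = +-isCommutativeMonoid }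

  open CommutativeMonoid +-commutativeMonoid public
    using ()
    renaming ( ∙-cong to +-cong; ∙-congʳ to +-congʳ
             ; identityˡ to +-identityˡ; identityʳ to +-identityʳ; comm to +-comm
             ; monoid to +-monoid )

  lattice : Lattice c ℓ
  lattice = record { isLattice = isLattice }

  open Lattice lattice public using (∧-cong; ∧-comm; ∨-comm)
  open LatticeProperties lattice public
    using (∧-idem; ∨-idem; ∨-∧-orderTheoreticLattice)
  open OrderTheoretic.Lattice ∨-∧-orderTheoreticLattice public
    using ( poset; meetSemilattice; x∧y≤x; x∧y≤y; x≤x∨y; y≤x∨y; ∨-least; ∧-greatest
          ; refl; trans; reflexive; antisym; module Eq )
  open MeetProperties meetSemilattice public using (∧-monotonic)
  open PosetReasoning poset
  open Mult +-monoid public using (_×_; ×-homo-+; ×-homo-1)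

  -- Order and metric: monotonicity, positivity, symmetry, triangle inequality.

  +-monoˡ-≤ : ∀ {x y} z → x ≤ y → (x + z) ≤ (y + z)
  +-monoˡ-≤ z x≤y = Eq.trans (+-congʳ x≤y) (proj₂ +-distrib-∧ z _ _)

  +-mono-≤ : ∀ {x y u v} → x ≤ y → u ≤ v → (x + u) ≤ (y + v)
  +-mono-≤ {x} {y} {u} {v} x≤y u≤v = begin
    x + u  ≤⟨ +-monoˡ-≤ u x≤y ⟩
    y + u  ≈⟨ +-comm y u ⟩
    u + y  ≤⟨ +-monoˡ-≤ y u≤v ⟩
    v + y  ≈⟨ +-comm v y ⟩
    y + v  ∎

  ∗-self : ∀ x → x ∗ x ≈ 0#
  ∗-self x = begin-equality
    x ∗ x                        ≈⟨ ∗-cong Eq.refl (∨-idem x) ⟨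
    x ∗ (x ∨ x)                  ≈⟨ ∧-idem _ ⟨
    x ∗ (x ∨ x) ∧ x ∗ (x ∨ x)    ≈⟨ ∗-∨-disjoint x x ⟩
    0#                           ∎

  -- Disjointness exhibits `0#` as a meet, so it lies below `x ∗ (x ∨ y)`; contractivity of joining
  -- with `x` bounds this by `x ∗ y`.
  ∗-nonneg : ∀ x y → 0# ≤ (x ∗ y)
  ∗-nonneg x y = begin
    0#                           ≈⟨ ∗-∨-disjoint x y ⟨
    x ∗ (x ∨ y) ∧ y ∗ (x ∨ y)    ≤⟨ x∧y≤x _ _ ⟩
    x ∗ (x ∨ y)                  ≈⟨ ∗-cong (∨-idem x) Eq.refl ⟨
    (x ∨ x) ∗ (x ∨ y)            ≤⟨ ∨-contraction x x y ⟩
    x ∗ y                        ∎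

  -- Here `x ∧ 0#` is `0#`, so `∗-∧-+` at `x` and `0#` collapses to the claim.
  nonneg⇒∗0≈ : ∀ {x} → 0# ≤ x → x ∗ 0# ≈ x
  nonneg⇒∗0≈ {x} 0≤x = begin-equality
    x ∗ 0#              ≈⟨ ∗-cong Eq.refl (Eq.trans 0≤x (∧-comm 0# x)) ⟩
    x ∗ (x ∧ 0#)        ≈⟨ +-identityʳ _ ⟨
    x ∗ (x ∧ 0#) + 0#   ≈⟨ ∗-∧-+ x 0# ⟩
    x ∨ 0#              ≈⟨ antisym (∨-least refl 0≤x) (x≤x∨y x 0#) ⟩
    x                   ∎

  -- Half of the symmetry of the metric, which suffices since `x` and `y` are arbitrary: `x ∗ y` is
  -- its own distance to `0#`, that is to `x ∗ x`, and `x ∗_` is a contraction.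
  ∗-comm-≤ : ∀ x y → (x ∗ y) ≤ (y ∗ x)
  ∗-comm-≤ x y = begin
    x ∗ y              ≈⟨ nonneg⇒∗0≈ (∗-nonneg x y) ⟨
    x ∗ y ∗ 0#         ≈⟨ ∗-cong Eq.refl (∗-self x) ⟨
    x ∗ y ∗ (x ∗ x)    ≤⟨ ∗-contraction x y x ⟩
    y ∗ x              ∎

  x≤x∗y+y : ∀ x y → x ≤ (x ∗ y + y)
  x≤x∗y+y x y = begin
    x                        ≤⟨ x≤x∨y x y ⟩
    x ∨ y                    ≈⟨ ∗-∧-+ x y ⟨
    x ∗ (x ∧ y) + y          ≈⟨ +-congʳ (∗-cong (∧-idem x) Eq.refl) ⟨
    (x ∧ x) ∗ (x ∧ y) + y    ≤⟨ +-monoˡ-≤ y (∧-contraction x x y) ⟩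
    x ∗ y + y                ∎

  ∗≈0⇒≤ : ∀ {x y} → x ∗ y ≈ 0# → x ≤ y
  ∗≈0⇒≤ {x} {y} x∗y≈0 = begin
    x            ≤⟨ x≤x∗y+y x y ⟩
    x ∗ y + y    ≈⟨ +-congʳ x∗y≈0 ⟩
    0# + y       ≈⟨ +-identityˡ y ⟩
    y            ∎

  ∗≈0⇒≈ : ∀ {x y} → x ∗ y ≈ 0# → x ≈ y
  ∗≈0⇒≈ {x} {y} x∗y≈0 = antisym (∗≈0⇒≤ x∗y≈0) (∗≈0⇒≤ y∗x≈0)
    where
    y∗x≈0 : y ∗ x ≈ 0#
    y∗x≈0 = antisym (trans (∗-comm-≤ y x) (reflexive x∗y≈0)) (∗-nonneg y x)

  ∗0-≤0⇒≈0 : ∀ {x} → (x ∗ 0#) ≤ 0# → x ≈ 0#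
  ∗0-≤0⇒≈0 {x} ∣x∣≤0 = ∗≈0⇒≈ (antisym ∣x∣≤0 (∗-nonneg x 0#))

  -- `x≤x∗y+y` is applied to the distances `z ∗ x` and `z ∗ y`, whose mutual distance is at most
  -- `x ∗ y` because `z ∗_` is a contraction.
  ∗-triangle : ∀ x y z → (x ∗ z) ≤ (x ∗ y + y ∗ z)
  ∗-triangle x y z = begin
    x ∗ z                        ≤⟨ ∗-comm-≤ x z ⟩
    z ∗ x                        ≤⟨ x≤x∗y+y (z ∗ x) (z ∗ y) ⟩
    z ∗ x ∗ (z ∗ y) + z ∗ y      ≤⟨ +-mono-≤ (∗-contraction z x y) (∗-comm-≤ z y) ⟩
    x ∗ y + y ∗ z                ∎

  +-subadditive : ∀ x y → ((x + y) ∗ 0#) ≤ (x ∗ 0# + y ∗ 0#)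
  +-subadditive x y = begin
    (x + y) ∗ 0#                         ≤⟨ ∗-triangle (x + y) x 0# ⟩
    (x + y) ∗ x + x ∗ 0#                 ≈⟨ +-congʳ (∗-cong Eq.refl (+-identityʳ x)) ⟨
    (x + y) ∗ (x + 0#) + x ∗ 0#          ≤⟨ +-monoˡ-≤ _ (+-contraction x y 0#) ⟩
    y ∗ 0# + x ∗ 0#                      ≈⟨ +-comm _ _ ⟩
    x ∗ 0# + y ∗ 0#                      ∎

  -- Enlarging the left `x` to `x + z` lets distributivity pull `z` out of the meet, leaving
  -- `x ∧ y`, which vanishes.
  ∧-+-disjoint : ∀ {x y z} → 0# ≤ z → x ∧ y ≈ 0# → (x ∧ (y + z)) ≤ (x ∧ z)
  ∧-+-disjoint {x} {y} {z} 0≤z x∧y≈0 = ∧-greatest (x∧y≤x _ _) (begin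
    x ∧ (y + z)          ≤⟨ ∧-monotonic x≤x+z refl ⟩
    (x + z) ∧ (y + z)    ≈⟨ proj₂ +-distrib-∧ z x y ⟨
    (x ∧ y) + z          ≈⟨ +-congʳ x∧y≈0 ⟩
    0# + z               ≈⟨ +-identityˡ z ⟩
    z                    ∎)
    where
    x≤x+z : x ≤ (x + z)
    x≤x+z = begin
      x         ≈⟨ +-identityʳ x ⟨
      x + 0#    ≤⟨ +-mono-≤ refl 0≤z ⟩
      x + z     ∎

  ×-nonneg : ∀ {x} n → 0# ≤ x → 0# ≤ (n × x)
  ×-nonneg zero    0≤x = refl
  ×-nonneg {x} (suc n) 0≤x = begin
    0#           ≈⟨ +-identityˡ 0# ⟨
    0# + 0#      ≤⟨ +-mono-≤ 0≤x (×-nonneg n 0≤x) ⟩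
    x + n × x    ∎

  ∧-×-disjoint : ∀ {x y} n → 0# ≤ y → x ∧ y ≈ 0# → (x ∧ n × y) ≤ 0#
  ∧-×-disjoint zero    0≤y x∧y≈0 = x∧y≤y _ _
  ∧-×-disjoint (suc n) 0≤y x∧y≈0 =
    trans (∧-+-disjoint (×-nonneg n 0≤y) x∧y≈0) (∧-×-disjoint n 0≤y x∧y≈0)

  -- Polars and principal ideals.

  polar : Carrier → Pred Carrier ℓ
  polar u x = (x ∗ 0# ∧ u) ≤ 0#

  -- For sums, the norm is subadditive and `∧-+-disjoint` drops the summand disjoint from `u`.
  polar-isIdeal : ∀ {u} → 0# ≤ u → IsIdeal A (polar u)
  polar-isIdeal {u} 0≤u = record
    { nonempty = 0# , trans (x∧y≤x _ _) (reflexive (∗-self 0#))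
    ; +-closed = λ {x} {y} x⊥u y⊥u → begin
        (x + y) ∗ 0# ∧ u         ≤⟨ ∧-monotonic (+-subadditive x y) refl ⟩
        (x ∗ 0# + y ∗ 0#) ∧ u    ≈⟨ ∧-comm _ _ ⟩
        u ∧ (x ∗ 0# + y ∗ 0#)    ≤⟨ ∧-+-disjoint (∗-nonneg y 0#) (disjoint x x⊥u) ⟩
        u ∧ y ∗ 0#               ≈⟨ ∧-comm _ _ ⟩
        y ∗ 0# ∧ u               ≤⟨ y⊥u ⟩
        0#                       ∎
    ; ∗-closed = λ x⊥u ∣y∣≤∣x∣ → trans (∧-monotonic ∣y∣≤∣x∣ refl) x⊥u
    }
    where
    disjoint : ∀ x → x ∈ polar u → u ∧ x ∗ 0# ≈ 0#
    disjoint x x⊥u = Eq.trans (∧-comm _ _) (antisym x⊥u (∧-greatest (∗-nonneg x 0#) 0≤u))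

  -- Describing the ideal by multiples of `u`, not as an intersection of ideals, keeps it at level
  -- `ℓ`, the level of the ideals that primality of `ker α` ranges over.
  principal : Carrier → Pred Carrier ℓ
  principal u x = ∃ λ n → (x ∗ 0#) ≤ (n × u)

  principal-isIdeal : ∀ u → IsIdeal A (principal u)
  principal-isIdeal u = record
    { nonempty = 0# , 0 , reflexive (∗-self 0#)
    ; +-closed = λ {x} {y} (m , ∣x∣≤mu) (n , ∣y∣≤nu) → m ℕ.+ n , (begin
        (x + y) ∗ 0#       ≤⟨ +-subadditive x y ⟩
        x ∗ 0# + y ∗ 0#    ≤⟨ +-mono-≤ ∣x∣≤mu ∣y∣≤nu ⟩
        m × u + n × u      ≈⟨ ×-homo-+ u m n ⟨
        (m ℕ.+ n) × u      ∎)
    ; ∗-closed = λ (n , ∣x∣≤nu) ∣y∣≤∣x∣ → n , trans ∣y∣≤∣x∣ ∣x∣≤nu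
    }

  -- The norm of `x` is disjoint from `u`, hence from every multiple of `u`, yet it lies below one
  -- of them.
  polar∩principal : ∀ {u x} → 0# ≤ u → x ∈ polar u ∩ principal u → x ≈ 0#
  polar∩principal {u} {x} 0≤u (x⊥u , n , ∣x∣≤nu) = ∗0-≤0⇒≈0 (begin
    x ∗ 0#             ≤⟨ ∧-greatest refl ∣x∣≤nu ⟩
    x ∗ 0# ∧ n × u     ≤⟨ ∧-×-disjoint n 0≤u ∣x∣∧u≈0 ⟩
    0#                 ∎)
    where
    ∣x∣∧u≈0 = antisym x⊥u (∧-greatest (∗-nonneg x 0#) 0≤u)

  -- The meet is nonnegative, so it is its own norm, and it lies below both norms.
  ∣x∣∧∣y∣∈I∩J : {I J : Pred Carrier p} → IsIdeal A I → IsIdeal A J →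
                ∀ {x y} → x ∈ I → y ∈ J → (x ∗ 0# ∧ y ∗ 0#) ∈ I ∩ J
  ∣x∣∧∣y∣∈I∩J I-ideal J-ideal {x} {y} x∈I y∈J =
      IsIdeal.∗-closed I-ideal x∈I (trans (reflexive ∣z∣≈z) (x∧y≤x _ _))
    , IsIdeal.∗-closed J-ideal y∈J (trans (reflexive ∣z∣≈z) (x∧y≤y _ _))
    where
    ∣z∣≈z = nonneg⇒∗0≈ (∧-greatest (∗-nonneg x 0#) (∗-nonneg y 0#))

-- Kernel and image of a homomorphism.

module _ {A B : ALMonoid c ℓ} (α : ALMonoidHomomorphism A B) where
  private
    module A = ALMonoidProperties A
    module B = ALMonoidProperties B
  open ALMonoidHomomorphism α
  open PosetReasoning B.poset

  ⟦⟧-mono-≤ : ∀ {x y} → x A.≤ y → ⟦ x ⟧ B.≤ ⟦ y ⟧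
  ⟦⟧-mono-≤ x≤y = B.Eq.trans (⟦⟧-cong x≤y) (∧-homo _ _)

  ⟦∗0⟧ : ∀ x → ⟦ x A.∗ A.0# ⟧ B.≈ ⟦ x ⟧ B.∗ B.0#
  ⟦∗0⟧ x = B.Eq.trans (∗-homo x A.0#) (B.∗-cong B.Eq.refl 0#-homo)

  ker-isIdeal : IsIdeal A (ker α)
  ker-isIdeal = record
    { nonempty = A.0# , 0#-homo
    ; +-closed = λ {x} {y} αx≈0 αy≈0 → begin-equality
        ⟦ x A.+ y ⟧        ≈⟨ +-homo x y ⟩
        ⟦ x ⟧ B.+ ⟦ y ⟧    ≈⟨ B.+-cong αx≈0 αy≈0 ⟩
        B.0# B.+ B.0#      ≈⟨ B.+-identityˡ B.0# ⟩
        B.0#               ∎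
    ; ∗-closed = λ {x} {y} αx≈0 ∣y∣≤∣x∣ → B.∗0-≤0⇒≈0 (begin
        ⟦ y ⟧ B.∗ B.0#     ≈⟨ ⟦∗0⟧ y ⟨
        ⟦ y A.∗ A.0# ⟧     ≤⟨ ⟦⟧-mono-≤ ∣y∣≤∣x∣ ⟩
        ⟦ x A.∗ A.0# ⟧     ≈⟨ ⟦∗0⟧ x ⟩
        ⟦ x ⟧ B.∗ B.0#     ≈⟨ B.∗-cong αx≈0 B.Eq.refl ⟩
        B.0# B.∗ B.0#      ≈⟨ B.∗-self B.0# ⟩
        B.0#               ∎)
    }

  -- The images of `x` and `x ∨ y` are at distance zero, hence equal.
  ∗-∨∈ker⇒≤ : ∀ {x y} → (x A.∗ (x A.∨ y)) ∈ ker α → ⟦ y ⟧ B.≤ ⟦ x ⟧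
  ∗-∨∈ker⇒≤ {x} {y} αu≈0 = begin
    ⟦ y ⟧              ≤⟨ B.y≤x∨y ⟦ x ⟧ ⟦ y ⟧ ⟩
    ⟦ x ⟧ B.∨ ⟦ y ⟧    ≈⟨ ∨-homo x y ⟨
    ⟦ x A.∨ y ⟧        ≈⟨ B.∗≈0⇒≈ (B.Eq.trans (B.Eq.sym (∗-homo x _)) αu≈0) ⟨
    ⟦ x ⟧              ∎

  prime⇒total : IsPrimeIdeal A (ker α) → ∀ x y → ⟦ x ⟧ B.≤ ⟦ y ⟧ ⊎ ⟦ y ⟧ B.≤ ⟦ x ⟧
  prime⇒total ker-prime x y
    with IsPrimeIdeal.prime ker-prime (A.polar u) (A.principal u)
           (A.polar-isIdeal 0≤u) (A.principal-isIdeal u)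
           (λ z∈ → B.Eq.trans (⟦⟧-cong (A.polar∩principal 0≤u z∈)) 0#-homo)
    where
    u = x A.∗ (x A.∨ y)
    0≤u = A.∗-nonneg x (x A.∨ y)
  ... | inj₁ polar⊆ker = inj₁ (∗-∨∈ker⇒≤ (B.Eq.trans (⟦⟧-cong v≈v′) (polar⊆ker v∈polar)))
    where
    -- With `x` and `y` exchanged, `∗-∨∈ker⇒≤` expects the join as `y ∨ x`, while the disjointness
    -- axiom supplies `x ∨ y`.
    v≈v′ = A.∗-cong A.Eq.refl (A.∨-comm y x)
    v∈polar = A.reflexive (A.Eq.trans
      (A.∧-cong (A.nonneg⇒∗0≈ (A.∗-nonneg y (x A.∨ y))) A.Eq.refl)
      (A.Eq.trans (A.∧-comm _ _) (A.∗-∨-disjoint x y)))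
  ... | inj₂ principal⊆ker = inj₂ (∗-∨∈ker⇒≤ (principal⊆ker (1 , ∣u∣≤1u)))
    where
    ∣u∣≤1u = A.reflexive (A.Eq.trans
      (A.nonneg⇒∗0≈ (A.∗-nonneg x (x A.∨ y))) (A.Eq.sym (A.×-homo-1 _)))

  prime⇒chain : IsPrimeIdeal A (ker α) → IsChain (image α)
  prime⇒chain ker-prime (_ , x , αx≈x′) (_ , y , αy≈y′) =
    map (resp αx≈x′ αy≈y′) (resp αy≈y′ αx≈x′) (prime⇒total ker-prime x y)
    where
    resp : ∀ {a a′ b b′} → a B.≈ a′ → b B.≈ b′ → a B.≤ b → a′ B.≤ b′
    resp a≈a′ b≈b′ a≤b = B.trans (B.reflexive (B.Eq.sym a≈a′)) (B.trans a≤b (B.reflexive b≈b′))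

  ∣x∣∧∣y∣∈ker⇒ : IsChain (image α) → ∀ x y →
                 (x A.∗ A.0# A.∧ y A.∗ A.0#) ∈ ker α → x ∈ ker α ⊎ y ∈ ker α
  -- A comparison is by definition an equation of the smaller element with the meet, so each case of
  -- `chain` feeds `lemma`, the second after commuting the meet.
  ∣x∣∧∣y∣∈ker⇒ chain x y αz≈0 = map (lemma x) (λ e → lemma y (B.Eq.trans e (B.∧-comm _ _)))
    (chain (_ , x A.∗ A.0# , B.Eq.refl) (_ , y A.∗ A.0# , B.Eq.refl))
    where
    lemma : ∀ w → ⟦ w A.∗ A.0# ⟧ B.≈ (⟦ x A.∗ A.0# ⟧ B.∧ ⟦ y A.∗ A.0# ⟧) → w ∈ ker α
    lemma w e = B.∗≈0⇒≈ (begin-equality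
      ⟦ w ⟧ B.∗ B.0#   ≈⟨ ⟦∗0⟧ w ⟨
      ⟦ w A.∗ A.0# ⟧   ≈⟨ e ⟩
      _                ≈⟨ ∧-homo _ _ ⟨
      _                ≈⟨ αz≈0 ⟩
      B.0#             ∎)

  chain⇒prime : ExcludedMiddle (c ⊔ ℓ) → IsChain (image α) → IsPrimeIdeal A (ker α)
  chain⇒prime em chain = record { isIdeal = ker-isIdeal ; prime = prime }
    where
    dne : DoubleNegationElimination ℓ
    -- `em` decides at level `c ⊔ ℓ`, so a proposition at level `ℓ` is lifted first.
    dne ¬¬P = lower (em⇒dne em {Lift c _} (λ ¬P → ¬¬P (¬P ∘ lift)))

    prime : (I J : Pred A.Carrier ℓ) → IsIdeal A I → IsIdeal A J →
            (I ∩ J) ⊆ ker α → (I ⊆ ker α) ⊎ (J ⊆ ker α)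
    prime I J I-ideal J-ideal I∩J⊆ker with em {J ⊆ ker α}
    ... | yes J⊆ker = inj₂ J⊆ker
    -- A single `x` in `I` outside the kernel would force every `y` in `J` into it.
    ... | no  J⊈ker = inj₁ λ {x} x∈I → dne λ x∉ker → J⊈ker λ {y} y∈J →
      fromInj₂ (λ x∈ker → contradiction x∈ker x∉ker)
        (∣x∣∧∣y∣∈ker⇒ chain x y (I∩J⊆ker (A.∣x∣∧∣y∣∈I∩J I-ideal J-ideal x∈I y∈J)))

theorem5p9 : ∀ {c ℓ} → ExcludedMiddle (c ⊔ ℓ) → (A B : ALMonoid c ℓ) (α : ALMonoidHomomorphism A B) → IsPrimeIdeal A (ker α) ⇔ IsChain (image α)
theorem5p9 em A B α = mk⇔ (prime⇒chain α) (chain⇒prime α em)
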